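{- Let $n\ge 1$ and $m$ be integers with $\binom{n}{2}-\lfloor n/2\rfloor\le m\le\binom{n}{2}$. Among all simple graphs with $n$ vertices and $m$ edges, the graph whose complement is a matching (with $\binom{n}{2}-m$ edges) has the maximum number of acyclic orientations.
   Context: An acyclic orientation of a simple graph is an assignment of directions to all its edges with no directed cycle. The complement of a graph $G$ on vertex set $V$ has edge set consisting of all pairs of distinct vertices of $V$ not adjacent in $G$. A matching is a set of pairwise vertex-disjoint edges. -}

module Defs where

open import Data.Nat using (ℕ)
open import Data.Bool using (Bool; true; false; not; _∧_; T)
open import Data.Bool.Properties using (T?)
open import Data.Fin using (Fin; toℕ)
open import Data.Vec using (Vec; lookup)
open import Data.List using (List; length; filter; allFin; concatMap; map)
open import Data.List.Membership.Propositional using (_∈_)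
open import Data.List.Relation.Unary.Unique.Propositional using (Unique)
open import Data.Product using (_×_; _,_; proj₁; proj₂)
open import Relation.Nullary using (¬_)
open import Relation.Nullary.Decidable using (⌊_⌋)
open import Relation.Binary.PropositionalEquality using (_≡_; _≢_)
open import Function.Bundles using (_⇔_)
import Data.Nat as ℕ

record Graph (n : ℕ) : Set where
  field
    adj    : Fin n → Fin n → Bool
    sym    : ∀ i j → adj i j ≡ adj j i
    irrefl : ∀ i → adj i i ≡ false
open Graph public

pairs : (n : ℕ) → List (Fin n × Fin n)
pairs n = concatMap (λ i → map (λ j → (i , j))
                               (filter (λ j → toℕ i ℕ.<? toℕ j) (allFin n)))
                    (allFin n)

edges : ∀ {n} → Graph n → List (Fin n × Fin n)
edges {n} G = filter (λ p → T? (adj G (proj₁ p) (proj₂ p))) (pairs n)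

numEdges : ∀ {n} → Graph n → ℕ
numEdges G = length (edges G)

-- Complement is a matching: every vertex has at most one non-neighbour
-- (other than itself).  (The complement's edges are the pairs of distinct
-- non-adjacent vertices; pairwise vertex-disjointness of these edges says
-- exactly that no vertex lies on two distinct complement edges.)

ComplementIsMatching : ∀ {n} → Graph n → Set
ComplementIsMatching {n} G =
  ∀ (i j k : Fin n) → j ≢ i → k ≢ i →
    adj G i j ≡ false → adj G i k ≡ false → j ≡ k

-- Orientations.  An orientation is a 0/1 matrix d with d i j = true
-- meaning the edge {i,j} is directed i → j.

Orient : ℕ → Set
Orient n = Vec (Vec Bool n) n

dir : ∀ {n} → Orient n → Fin n → Fin n → Bool
dir o i j = lookup (lookup o i) j

IsOrientation : ∀ {n} → Graph n → Orient n → Set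
IsOrientation {n} G o =
  (∀ (i j : Fin n) → dir o i j ≡ true → adj G i j ≡ true) ×
  (∀ (i j : Fin n) → adj G i j ≡ true → dir o i j ≡ not (dir o j i))

data Walk {n : ℕ} (o : Orient n) : Fin n → Fin n → Set where
  edge : ∀ {i j}   → dir o i j ≡ true → Walk o i j
  _∷_  : ∀ {i j k} → dir o i j ≡ true → Walk o j k → Walk o i k

Acyclic : ∀ {n} → Orient n → Set
Acyclic {n} o = ∀ (i : Fin n) → ¬ Walk o i i

AcyclicOrientation : ∀ {n} → Graph n → Orient n → Set
AcyclicOrientation G o = IsOrientation G o × Acyclic o

NumAcyclicOrientations : ∀ {n} → Graph n → ℕ → Set
NumAcyclicOrientations {n} G k =
  Data.Product.Σ (List (Orient n)) λ L →
    Unique L × length L ≡ k × (∀ o → (o ∈ L) ⇔ AcyclicOrientation G o)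

{-# OPTIONS --safe #-}

-- Write a(G) for the number of acyclic orientations of G.  Deletion–contraction reads
-- a(F) = a(F − e) + a(F / e), where a(F / e) counts the acyclic orientations of F − e in
-- which the ends of e are incomparable.  Let vu be an edge of F and v′ a vertex adjacent to
-- all others.  In F / v′u the merged vertex is adjacent to everything, so up to the name of
-- that vertex F / v′u is a subgraph of F / vu, where v′ keeps this role.  Hence
-- a(F / v′u) ≤ a(F / vu) and a(F − vu) ≤ a(F − v′u): moving one end of a complement edge to
-- a vertex isolated in the complement does not decrease a.  Since H is a matching with the
-- same number c of complement edges, 2c ≤ n, and there are enough vertices to move the ends of
-- the complement edges of G apart one after the other, until they form a matching too;
-- two such graphs differ by a relabelling.
module Submission where

open import Defs
open import Data.Nat using (ℕ; zero; suc; _+_; _*_; _≤_; _<_; _∸_; _/_; z≤n; s≤s)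
import Data.Nat.Properties as ℕ
open import Data.Nat.Combinatorics using (_C_)
open import Data.Bool using (Bool; true; false; not; _∧_; T)
import Data.Bool.Properties as Bool
open import Data.Empty using (⊥)
open import Data.Unit using (tt)
open import Data.Product using (_×_; _,_; proj₁; proj₂; Σ; ∃)
import Data.Sum as Sum
open import Data.Sum using (_⊎_; inj₁; inj₂; [_,_]′)
open import Data.Fin using (Fin; toℕ)
import Data.Fin.Properties as Fin
open import Data.Fin.Permutation
  using (Permutation′; transpose; _∘ₚ_; _⟨$⟩ʳ_; _⟨$⟩ˡ_; inverseˡ; inverseʳ) renaming (id to idₚ)
open import Data.Vec using (Vec; []; _∷_; lookup; tabulate)
import Data.Vec.Properties as Vec
open import Data.List using (List; []; _∷_; _++_; length; filter; map; allFin; cartesianProductWith)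
import Data.List.Properties as List
open import Data.List.Membership.Propositional using (_∈_; _∉_; find; lose)
open import Data.List.Membership.Propositional.Properties
open import Data.List.Relation.Unary.Any using (here; there)
open import Data.List.Relation.Unary.All using (All; []; _∷_)
import Data.List.Relation.Unary.All as All
import Data.List.Relation.Unary.All.Properties as All
open import Data.List.Relation.Unary.AllPairs using ([]; _∷_)
import Data.List.Relation.Unary.AllPairs as AllPairs
import Data.List.Relation.Unary.AllPairs.Properties as AllPairs
open import Data.List.Relation.Unary.Unique.Propositional using (Unique)
import Data.List.Relation.Unary.Unique.Propositional.Properties as Unique
import Data.List.Relation.Binary.Permutation.Propositional as Permutation
import Data.List.Relation.Binary.Permutation.Propositional.Properties as Permutation
open import Function using (_∘_; id)
open import Function.Bundles using (mk⇔; Equivalence)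
open import Relation.Nullary using (¬_; Dec; yes; no; contradiction; does)
open import Relation.Nullary.Decidable
  using (_×-dec_; _⊎-dec_; _→-dec_; ¬?; map′; dec-true; dec-false; does-⇔; toSum)
open import Relation.Unary using (Decidable)
open import Relation.Binary using (tri<; tri≈; tri>)
open import Relation.Binary.PropositionalEquality
  using (_≡_; _≢_; refl; trans; cong; cong₂; subst; ≢-sym; module ≡-Reasoning)
  renaming (sym to ≡-sym)

-- Counting with duplicate-free lists

private variable
  A B : Set
  n : ℕ

-- Pigeonhole by induction on `xs`: cut one occurrence of `f x` out of `ys`; by injectivity the
-- images of the other members lie in what remains. Injectivity is asked only on members of `xs`, so
-- that it may rest on the property by which a list was filtered.
length-injection : (f : A → B) {xs : List A} {ys : List B} → Unique xs →
  (∀ {x} → x ∈ xs → f x ∈ ys) →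
  (∀ {x y} → x ∈ xs → y ∈ xs → f x ≡ f y → x ≡ y) →
  length xs ≤ length ys
length-injection f {[]} _ _ _ = z≤n
length-injection f {x ∷ xs} (x# ∷ uniq) sub inj with ∈-∃++ (sub (here refl))
... | as , bs , refl = begin
  suc (length xs)          ≤⟨ s≤s (length-injection f uniq sub′ (λ p q → inj (there p) (there q))) ⟩
  suc (length (as ++ bs))  ≡⟨ cong suc (List.length-++ as) ⟩
  suc (length as + length bs) ≡⟨ ℕ.+-suc (length as) (length bs) ⟨
  length as + suc (length bs) ≡⟨ List.length-++ as ⟨
  length (as ++ f x ∷ bs)  ∎
  where
  open ℕ.≤-Reasoning
  sub′ : ∀ {y} → y ∈ xs → f y ∈ as ++ bs
  sub′ {y} y∈ with ∈-++⁻ as (sub (there y∈))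
  ... | inj₁ p           = ∈-++⁺ˡ p
  ... | inj₂ (there p)   = ∈-++⁺ʳ as p
  ... | inj₂ (here fy≡fx) = contradiction (inj (here refl) (there y∈) (≡-sym fy≡fx)) (All.lookup x# y∈)

Unique-⊆-length : {xs ys : List A} → Unique xs → (∀ {x} → x ∈ xs → x ∈ ys) → length xs ≤ length ys
Unique-⊆-length uniq sub = length-injection id uniq sub (λ _ _ eq → eq)

length-filter-⊎ : {P Q R : A → Set} (P? : Decidable P) (Q? : Decidable Q) (R? : Decidable R) →
  (∀ x → P x → Q x ⊎ R x) → (∀ x → Q x → P x) → (∀ x → R x → P x) → (∀ x → Q x → ¬ R x) →
  ∀ xs → length (filter P? xs) ≡ length (filter Q? xs) + length (filter R? xs)
length-filter-⊎ P? Q? R? split Q⇒P R⇒P Q⇒¬R [] = refl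
length-filter-⊎ P? Q? R? split Q⇒P R⇒P Q⇒¬R (x ∷ xs)
  with length-filter-⊎ P? Q? R? split Q⇒P R⇒P Q⇒¬R xs | P? x | Q? x | R? x
... | ih | _     | yes q | yes r = contradiction r (Q⇒¬R x q)
... | ih | yes _ | yes _ | no  _ = cong suc ih
... | ih | yes _ | no  _ | yes _ = trans (cong suc ih) (≡-sym (ℕ.+-suc _ _))
... | ih | yes p | no ¬q | no ¬r = contradiction (split x p) [ ¬q , ¬r ]′
... | ih | no ¬p | yes q | no _  = contradiction (Q⇒P x q) ¬p
... | ih | no ¬p | no _  | yes r = contradiction (R⇒P x r) ¬p
... | ih | no _  | no _  | no  _ = ih

-- Enumeration of all 0/1 matrices

vecs : List A → ∀ n → List (Vec A n)
vecs xs zero    = [] ∷ []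
vecs xs (suc n) = cartesianProductWith _∷_ xs (vecs xs n)

vecs-unique : {xs : List A} → Unique xs → ∀ n → Unique (vecs xs n)
vecs-unique uniq zero    = [] ∷ []
vecs-unique uniq (suc n) = Unique.cartesianProductWith⁺ _∷_ Vec.∷-injective uniq (vecs-unique uniq n)

vecs-complete : {xs : List A} → (∀ x → x ∈ xs) → (v : Vec A n) → v ∈ vecs xs n
vecs-complete all []      = here refl
vecs-complete all (x ∷ v) = ∈-cartesianProductWith⁺ _∷_ (all x) (vecs-complete all v)

orients : ∀ n → List (Orient n)
orients n = vecs (vecs (true ∷ false ∷ []) n) n

orients-unique : ∀ n → Unique (orients n)
orients-unique n = vecs-unique (vecs-unique (((λ ()) ∷ []) ∷ [] ∷ []) n) n

orients-complete : (o : Orient n) → o ∈ orients n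
orients-complete = vecs-complete (vecs-complete λ { true → here refl ; false → there (here refl) })

-- All counts filter the same complete duplicate-free list, so two of them can be compared by a map
-- on matrices alone.
count : {P : Orient n → Set} → Decidable P → ℕ
count P? = length (filter P? (orients _))

count-injection : {P Q : Orient n → Set} (P? : Decidable P) (Q? : Decidable Q) (f : Orient n → Orient n) →
  (∀ o → P o → Q (f o)) → (∀ o o′ → P o → P o′ → f o ≡ f o′ → o ≡ o′) → count P? ≤ count Q?
count-injection P? Q? f P⇒Q inj = length-injection f (Unique.filter⁺ P? (orients-unique _))
  (λ o∈ → ∈-filter⁺ Q? (orients-complete _) (P⇒Q _ (P-of o∈)))
  (λ p q → inj _ _ (P-of p) (P-of q))
  where
  P-of : ∀ {o} → o ∈ filter P? (orients _) → _
  P-of o∈ = proj₂ (∈-filter⁻ P? {xs = orients _} o∈)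

count-mono : {P Q : Orient n → Set} (P? : Decidable P) (Q? : Decidable Q) →
  (∀ o → P o → Q o) → count P? ≤ count Q?
count-mono P? Q? P⇒Q = count-injection P? Q? id P⇒Q (λ _ _ _ _ eq → eq)

fromDir : (Fin n → Fin n → Bool) → Orient n
fromDir f = tabulate λ i → tabulate (f i)

dir-fromDir : (f : Fin n → Fin n → Bool) → ∀ i j → dir (fromDir f) i j ≡ f i j
dir-fromDir f i j = trans (cong (λ v → lookup v j) (Vec.lookup∘tabulate _ i)) (Vec.lookup∘tabulate (f i) j)

lookup-ext : {v w : Vec A n} → (∀ i → lookup v i ≡ lookup w i) → v ≡ w
lookup-ext {v = v} {w} eq =
  trans (≡-sym (Vec.tabulate∘lookup v)) (trans (Vec.tabulate-cong eq) (Vec.tabulate∘lookup w))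

dir-ext : {o o′ : Orient n} → (∀ i j → dir o i j ≡ dir o′ i j) → o ≡ o′
dir-ext eq = lookup-ext λ i → lookup-ext (eq i)

-- Walks and linear extensions

_▷_ : {o : Orient n} {i j k : Fin n} → Walk o i j → Walk o j k → Walk o i k
edge d   ▷ w = d ∷ w
(d ∷ w′) ▷ w = d ∷ (w′ ▷ w)

-- Floyd–Warshall: walks all of whose interior vertices lie in the list.
Reach : Orient n → List (Fin n) → Fin n → Fin n → Set
Reach o []       i j = dir o i j ≡ true
Reach o (k ∷ ks) i j = Reach o ks i j ⊎ (Reach o ks i k × Reach o ks k j)

reach? : (o : Orient n) → ∀ ks i j → Dec (Reach o ks i j)
reach? o []       i j = dir o i j Bool.≟ true
reach? o (k ∷ ks) i j = reach? o ks i j ⊎-dec (reach? o ks i k ×-dec reach? o ks k j)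

reach⇒walk : (o : Orient n) → ∀ ks {i j} → Reach o ks i j → Walk o i j
reach⇒walk o []       d               = edge d
reach⇒walk o (k ∷ ks) (inj₁ r)        = reach⇒walk o ks r
reach⇒walk o (k ∷ ks) (inj₂ (r , r′)) = reach⇒walk o ks r ▷ reach⇒walk o ks r′

-- Passing through `m` needs no larger list, since `m` belongs to it. If `m` is the head, keep the
-- part before its first visit and the part after its last. If it lies deeper and both walks visit
-- `k`, the detour from `k` through `m` back to `k` is dropped.
reach-trans : (o : Orient n) → ∀ {ks i m j} → m ∈ ks → Reach o ks i m → Reach o ks m j → Reach o ks i j
reach-trans o (here refl) (inj₁ p)       (inj₁ q)       = inj₂ (p , q)
reach-trans o (here refl) (inj₁ p)       (inj₂ (_ , q)) = inj₂ (p , q)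
reach-trans o (here refl) (inj₂ (p , _)) (inj₁ q)       = inj₂ (p , q)
reach-trans o (here refl) (inj₂ (p , _)) (inj₂ (_ , q)) = inj₂ (p , q)
reach-trans o (there m∈)  (inj₁ p)       (inj₁ q)       = inj₁ (reach-trans o m∈ p q)
reach-trans o (there m∈)  (inj₁ p)       (inj₂ (q , r)) = inj₂ (reach-trans o m∈ p q , r)
reach-trans o (there m∈)  (inj₂ (p , q)) (inj₁ r)       = inj₂ (p , reach-trans o m∈ q r)
reach-trans o (there m∈)  (inj₂ (p , _)) (inj₂ (_ , q)) = inj₂ (p , q)

dir⇒reach : (o : Orient n) → ∀ ks {i j} → dir o i j ≡ true → Reach o ks i j
dir⇒reach o []       d = d
dir⇒reach o (k ∷ ks) d = inj₁ (dir⇒reach o ks d)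

walk⇒reach : (o : Orient n) → ∀ {i j} → Walk o i j → Reach o (allFin n) i j
walk⇒reach o (edge d) = dir⇒reach o _ d
walk⇒reach o (d ∷ w)  = reach-trans o (∈-allFin _) (dir⇒reach o _ d) (walk⇒reach o w)

walk? : (o : Orient n) → ∀ i j → Dec (Walk o i j)
walk? o i j = map′ (reach⇒walk o _) (walk⇒reach o) (reach? o (allFin _) i j)

isOrientation? : (G : Graph n) → Decidable (IsOrientation G)
isOrientation? G o =
  Fin.all? (λ i → Fin.all? λ j → (dir o i j Bool.≟ true) →-dec (adj G i j Bool.≟ true)) ×-dec
  Fin.all? (λ i → Fin.all? λ j → (adj G i j Bool.≟ true) →-dec (dir o i j Bool.≟ not (dir o j i)))

acyclic? : Decidable (Acyclic {n})
acyclic? o = Fin.all? λ i → ¬? (walk? o i i)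

ao? : (G : Graph n) → Decidable (AcyclicOrientation G)
ao? G o = isOrientation? G o ×-dec acyclic? o

#AO : Graph n → ℕ
#AO G = count (ao? G)

-- Two duplicate-free lists with the same members are equally long, so the relational count agrees
-- with the computed one.
numAO-unique : (G : Graph n) {k : ℕ} → NumAcyclicOrientations G k → k ≡ #AO G
numAO-unique G (L , uniq , refl , spec) = ℕ.≤-antisym
  (Unique-⊆-length uniq λ o∈ → ∈-filter⁺ (ao? G) (orients-complete _) (Equivalence.to (spec _) o∈))
  (Unique-⊆-length (Unique.filter⁺ (ao? G) (orients-unique _))
    λ o∈ → Equivalence.from (spec _) (proj₂ (∈-filter⁻ (ao? G) {xs = orients _} o∈)))

rank : Orient n → Fin n → ℕ
rank o i = length (filter (λ k → walk? o k i) (allFin _))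

-- Every vertex with a walk to `i` has one to `j`. In addition `i` itself counts for `j`, while
-- acyclicity keeps it out of its own count.
rank-mono : (o : Orient n) → Acyclic o → ∀ {i j} → dir o i j ≡ true → rank o i < rank o j
rank-mono o acyc {i} {j} d = Unique-⊆-length
  (All.tabulate (λ k∈ → λ { refl → acyc i (walk k∈) }) ∷ Unique.filter⁺ (λ k → walk? o k i) (Unique.allFin⁺ _))
  λ { (here refl) → ∈-filter⁺ (λ k → walk? o k j) (∈-allFin _) (edge d)
    ; (there k∈)  → ∈-filter⁺ (λ k → walk? o k j) (∈-allFin _) (walk k∈ ▷ edge d) }
  where
  walk : ∀ {k} → k ∈ filter (λ k → walk? o k i) (allFin _) → Walk o k i
  walk k∈ = proj₂ (∈-filter⁻ (λ k → walk? o k i) {xs = allFin _} k∈)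

-- A linear extension: order by rank, ties broken by the vertex label.
pos : Orient n → Fin n → ℕ
pos {n} o i = rank o i * n + toℕ i

-- Labels are below `n`, so they never outweigh a difference in rank.
rank<⇒pos< : (o : Orient n) → ∀ {i j} → rank o i < rank o j → pos o i < pos o j
rank<⇒pos< {n} o {i} {j} lt = begin-strict
  rank o i * n + toℕ i <⟨ ℕ.+-monoʳ-< (rank o i * n) (Fin.toℕ<n i) ⟩
  rank o i * n + n     ≡⟨ ℕ.+-comm _ n ⟩
  suc (rank o i) * n   ≤⟨ ℕ.*-monoˡ-≤ n lt ⟩
  rank o j * n         ≤⟨ ℕ.m≤m+n _ _ ⟩
  rank o j * n + toℕ j ∎
  where open ℕ.≤-Reasoning

pos-mono : (o : Orient n) → Acyclic o → ∀ {i j} → dir o i j ≡ true → pos o i < pos o j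
pos-mono o acyc d = rank<⇒pos< o (rank-mono o acyc d)

pos-injective : (o : Orient n) → ∀ {i j} → pos o i ≡ pos o j → i ≡ j
pos-injective {n} o {i} {j} eq with ℕ.<-cmp (rank o i) (rank o j)
... | tri< lt _ _ = contradiction eq (ℕ.<⇒≢ (rank<⇒pos< o lt))

... | tri> _ _ gt = contradiction (≡-sym eq) (ℕ.<⇒≢ (rank<⇒pos< o gt))
... | tri≈ _ req _ = Fin.toℕ-injective (ℕ.+-cancelˡ-≡ (rank o i * n) _ _
  (trans eq (cong (λ r → r * n + toℕ j) (≡-sym req))))

-- Bijections, and orientations built from decidable relations

count-bijection : {P Q : Orient n → Set} (P? : Decidable P) (Q? : Decidable Q) (f g : Orient n → Orient n) →
  (∀ o → P o → Q (f o)) → (∀ o → Q o → P (g o)) →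
  (∀ o → P o → g (f o) ≡ o) → (∀ o → Q o → f (g o) ≡ o) → count P? ≡ count Q?
count-bijection P? Q? f g P⇒Q Q⇒P gf fg = ℕ.≤-antisym
  (count-injection P? Q? f P⇒Q λ o o′ p p′ eq → trans (≡-sym (gf o p)) (trans (cong g eq) (gf o′ p′)))
  (count-injection Q? P? g Q⇒P λ o o′ q q′ eq → trans (≡-sym (fg o q)) (trans (cong f eq) (fg o′ q′)))

⇔-true : {a b : Bool} → (a ≡ true → b ≡ true) → (b ≡ true → a ≡ true) → a ≡ b
⇔-true {true}  {b}     f g = ≡-sym (f refl)
⇔-true {false} {true}  f g = g refl
⇔-true {false} {false} f g = refl

module _ {D : Fin n → Fin n → Set} (D? : ∀ i j → Dec (D i j)) where

  orientOf : Orient n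
  orientOf = fromDir λ i j → does (D? i j)

  orientOf⁺ : ∀ {i j} → D i j → dir orientOf i j ≡ true
  orientOf⁺ {i} {j} d = trans (dir-fromDir _ i j) (dec-true (D? i j) d)

  orientOf⁻ : ∀ {i j} → dir orientOf i j ≡ true → D i j
  orientOf⁻ {i} {j} d with D? i j | trans (≡-sym (dir-fromDir (λ i j → does (D? i j)) i j)) d
  ... | yes p | _ = p

orient-ext : {o o′ : Orient n} → (∀ i j → dir o i j ≡ true → dir o′ i j ≡ true) →
  (∀ i j → dir o′ i j ≡ true → dir o i j ≡ true) → o ≡ o′
orient-ext f g = dir-ext λ i j → ⇔-true (f i j) (g i j)

acyclic-asym : {o : Orient n} → Acyclic o → ∀ {i j} → dir o i j ≡ true → dir o j i ≢ true
acyclic-asym acyc d d′ = acyc _ (d ∷ edge d′)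

-- Acyclicity rules out both directions at once, so for each edge it is enough to find one direction
-- that is present.
acyclicOrientation : {G : Graph n} {o : Orient n} →
  (∀ {i j} → dir o i j ≡ true → adj G i j ≡ true) →
  (∀ {i j} → adj G i j ≡ true → dir o i j ≡ true ⊎ dir o j i ≡ true) →
  Acyclic o → AcyclicOrientation G o
acyclicOrientation {o = o} sub total acyc = ((λ _ _ → sub) , opposite) , acyc
  where
  opposite : ∀ i j → _ → dir o i j ≡ not (dir o j i)
  opposite i j a with dir o i j in dij | dir o j i in dji
  ... | true  | true  = contradiction dji (acyclic-asym {o = o} acyc dij)
  ... | true  | false = refl
  ... | false | true  = refl
  ... | false | false with total a
  ...   | inj₁ d with () ← trans (≡-sym dij) d
  ...   | inj₂ d with () ← trans (≡-sym dji) d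

module _ (G : Graph n) {o : Orient n} (ao : AcyclicOrientation G o) where

  AO-sub : ∀ {i j} → dir o i j ≡ true → adj G i j ≡ true
  AO-sub = proj₁ (proj₁ ao) _ _

  AO-total : ∀ {i j} → adj G i j ≡ true → dir o i j ≡ true ⊎ dir o j i ≡ true
  AO-total {i} {j} a with dir o i j | dir o j i | proj₂ (proj₁ ao) i j a
  ... | true  | _    | _ = inj₁ refl
  ... | false | true | _ = inj₂ refl

-- Deletion–contraction

Joins : Fin n → Fin n → Fin n → Fin n → Set
Joins x y i j = (i ≡ x × j ≡ y) ⊎ (i ≡ y × j ≡ x)

joins? : (x y i j : Fin n) → Dec (Joins x y i j)
joins? x y i j = (i Fin.≟ x ×-dec j Fin.≟ y) ⊎-dec (i Fin.≟ y ×-dec j Fin.≟ x)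

joins-sym : {x y i j : Fin n} → Joins x y i j → Joins x y j i
joins-sym (inj₁ (p , q)) = inj₂ (q , p)
joins-sym (inj₂ (p , q)) = inj₁ (q , p)

joins-swap : {x y i j : Fin n} → Joins x y i j → Joins y x i j
joins-swap (inj₁ p) = inj₂ p
joins-swap (inj₂ p) = inj₁ p

deleteEdge : Graph n → Fin n → Fin n → Graph n
deleteEdge G x y .adj i j = adj G i j ∧ not (does (joins? x y i j))
deleteEdge G x y .sym i j = cong₂ (λ a b → a ∧ not b) (Graph.sym G i j)
  (does-⇔ (mk⇔ joins-sym joins-sym) (joins? x y i j) (joins? x y j i))
deleteEdge G x y .irrefl i = cong (_∧ _) (Graph.irrefl G i)

module _ {G : Graph n} {x y : Fin n} where

  deleteEdge⁺ : ∀ {i j} → adj G i j ≡ true → ¬ Joins x y i j → adj (deleteEdge G x y) i j ≡ true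
  deleteEdge⁺ {i} {j} a ¬xy = cong₂ (λ a b → a ∧ not b) a (dec-false (joins? x y i j) ¬xy)

  deleteEdge⁻ : ∀ {i j} → adj (deleteEdge G x y) i j ≡ true → adj G i j ≡ true × ¬ Joins x y i j
  deleteEdge⁻ {i} {j} a = Bool.∧-conicalˡ _ _ a , λ xy → contradiction
    (trans (≡-sym (Bool.∧-conicalʳ (adj G i j) _ a)) (cong not (dec-true (joins? x y i j) xy))) λ ()

adj⇒≢ : (G : Graph n) → ∀ {i j} → adj G i j ≡ true → i ≢ j
adj⇒≢ G {i} a refl with trans (≡-sym a) (Graph.irrefl G i)
... | ()

adj-sym : (G : Graph n) → ∀ {i j} → adj G i j ≡ true → adj G j i ≡ true
adj-sym G a = trans (Graph.sym G _ _) a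

-- These are the acyclic orientations of `G` to which an arc from `y` to `x` can be added without
-- closing a cycle.
AvoidsWalk : Graph n → Fin n → Fin n → Orient n → Set
AvoidsWalk G x y o = AcyclicOrientation G o × ¬ Walk o x y

avoidsWalk? : (G : Graph n) → ∀ x y → Decidable (AvoidsWalk G x y)
avoidsWalk? G x y o = ao? G o ×-dec ¬? (walk? o x y)

-- These correspond to the acyclic orientations of G with x and y identified.
Separated : Graph n → Fin n → Fin n → Orient n → Set
Separated G x y o = AcyclicOrientation G o × ¬ Walk o x y × ¬ Walk o y x

separated? : (G : Graph n) → ∀ x y → Decidable (Separated G x y)
separated? G x y o = ao? G o ×-dec (¬? (walk? o x y) ×-dec ¬? (walk? o y x))

module _ (F : Graph n) {x y : Fin n} (xy : adj F x y ≡ true) where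
  private
    G : Graph n
    G = deleteEdge F x y

    x≢y : x ≢ y
    x≢y = adj⇒≢ F xy

    Directed : Orient n → Set
    Directed o = AcyclicOrientation F o × dir o x y ≡ true

  directed? : Decidable Directed
  directed? o = ao? F o ×-dec (dir o x y Bool.≟ true)

  private
    del? : ∀ o i j → Dec (dir o i j ≡ true × ¬ Joins x y i j)
    del? o i j = (dir o i j Bool.≟ true) ×-dec ¬? (joins? x y i j)

    add? : ∀ o i j → Dec (dir o i j ≡ true ⊎ (i ≡ x × j ≡ y))
    add? o i j = (dir o i j Bool.≟ true) ⊎-dec (i Fin.≟ x ×-dec j Fin.≟ y)

    del add : Orient n → Orient n
    del o = orientOf (del? o)
    add o = orientOf (add? o)

    del-walk : ∀ o {i j} → Walk (del o) i j → Walk o i j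
    del-walk o (edge d) = edge (proj₁ (orientOf⁻ (del? o) d))
    del-walk o (d ∷ w)  = proj₁ (orientOf⁻ (del? o) d) ∷ del-walk o w

    Walk⁼ : Orient n → Fin n → Fin n → Set
    Walk⁼ o i j = i ≡ j ⊎ Walk o i j

    cons : ∀ o {i j k} → dir o i j ≡ true → Walk⁼ o j k → Walk⁼ o i k
    cons o d (inj₁ refl) = inj₂ (edge d)
    cons o d (inj₂ w)    = inj₂ (d ∷ w)

    -- A walk that uses the new arc is cut at its first and at its last use; the outer pieces,
    -- possibly empty, are walks of `o`.
    add-walk : ∀ o {i j} → Walk (add o) i j → Walk o i j ⊎ (Walk⁼ o i x × Walk⁼ o y j)
    add-walk o (edge d) with orientOf⁻ (add? o) d
    ... | inj₁ d′            = inj₁ (edge d′)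
    ... | inj₂ (refl , refl) = inj₂ (inj₁ refl , inj₁ refl)
    add-walk o (d ∷ w) with orientOf⁻ (add? o) d | add-walk o w
    ... | inj₁ d′            | inj₁ w′        = inj₁ (d′ ∷ w′)
    ... | inj₁ d′            | inj₂ (w₁ , w₂) = inj₂ (cons o d′ w₁ , w₂)
    ... | inj₂ (refl , refl) | inj₁ w′        = inj₂ (inj₁ refl , inj₂ w′)
    ... | inj₂ (refl , refl) | inj₂ (w₁ , w₂) = inj₂ (inj₁ refl , w₂)

    add-acyclic : ∀ o → Acyclic o → ¬ Walk o y x → Acyclic (add o)
    add-acyclic o acyc ¬yx i w with add-walk o w
    ... | inj₁ w′                    = acyc i w′
    -- Two empty pieces would make `i` both ends of the arc.
    ... | inj₂ (inj₁ refl , inj₁ eq) = x≢y (≡-sym eq)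
    ... | inj₂ (inj₁ refl , inj₂ w₂) = ¬yx w₂
    ... | inj₂ (inj₂ w₁ , inj₁ refl) = ¬yx w₁
    -- Around the closed walk, the last piece followed by the first leads from `y` to `x`.
    ... | inj₂ (inj₂ w₁ , inj₂ w₂)   = ¬yx (w₂ ▷ w₁)

    del-AO : ∀ o → Directed o → AvoidsWalk G y x (del o)
    del-AO o (ao , d) = acyclicOrientation {G = G} sub total (λ i w → proj₂ ao i (del-walk o w))
                      -- A walk from `y` to `x` would close a cycle of `o` with the deleted arc from
                      -- `x` to `y`.
                      , (λ w → proj₂ ao x (d ∷ del-walk o w))
      where
      sub : ∀ {i j} → dir (del o) i j ≡ true → adj G i j ≡ true
      sub d with orientOf⁻ (del? o) d
      ... | d′ , ¬xy = deleteEdge⁺ {G = F} (AO-sub F ao d′) ¬xy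
      total : ∀ {i j} → adj G i j ≡ true → dir (del o) i j ≡ true ⊎ dir (del o) j i ≡ true
      total a with deleteEdge⁻ {G = F} a
      ... | a′ , ¬xy with AO-total F ao a′
      ... | inj₁ d′ = inj₁ (orientOf⁺ (del? o) (d′ , ¬xy))
      ... | inj₂ d′ = inj₂ (orientOf⁺ (del? o) (d′ , ¬xy ∘ joins-sym))

    add-AO : ∀ o → AvoidsWalk G y x o → Directed (add o)
    add-AO o (ao , ¬yx) = acyclicOrientation {G = F} sub total (add-acyclic o (proj₂ ao) ¬yx)
                        , orientOf⁺ (add? o) (inj₂ (refl , refl))
      where
      sub : ∀ {i j} → dir (add o) i j ≡ true → adj F i j ≡ true
      sub d with orientOf⁻ (add? o) d
      ... | inj₁ d′            = proj₁ (deleteEdge⁻ {G = F} (AO-sub G ao d′))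
      ... | inj₂ (refl , refl) = xy
      total : ∀ {i j} → adj F i j ≡ true → dir (add o) i j ≡ true ⊎ dir (add o) j i ≡ true
      total {i} {j} a with joins? x y i j
      ... | yes (inj₁ p) = inj₁ (orientOf⁺ (add? o) (inj₂ p))
      ... | yes (inj₂ (p , q)) = inj₂ (orientOf⁺ (add? o) (inj₂ (q , p)))
      ... | no ¬xy with AO-total G ao (deleteEdge⁺ {G = F} a ¬xy)
      ... | inj₁ d′ = inj₁ (orientOf⁺ (add? o) (inj₁ d′))
      ... | inj₂ d′ = inj₂ (orientOf⁺ (add? o) (inj₁ d′))

    add-del : ∀ o → Directed o → add (del o) ≡ o
    add-del o (ao , d) = orient-ext to from
      where
      to : ∀ i j → dir (add (del o)) i j ≡ true → dir o i j ≡ true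
      to i j e with orientOf⁻ (add? (del o)) e
      ... | inj₁ e′            = proj₁ (orientOf⁻ (del? o) e′)
      ... | inj₂ (refl , refl) = d
      from : ∀ i j → dir o i j ≡ true → dir (add (del o)) i j ≡ true
      from i j e with joins? x y i j
      ... | yes (inj₁ p)             = orientOf⁺ (add? (del o)) (inj₂ p)
      ... | yes (inj₂ (refl , refl)) = contradiction e (acyclic-asym {o = o} (proj₂ ao) d)
      ... | no ¬xy = orientOf⁺ (add? (del o)) (inj₁ (orientOf⁺ (del? o) (e , ¬xy)))

    del-add : ∀ o → AvoidsWalk G y x o → del (add o) ≡ o
    del-add o (ao , _) = orient-ext to from
      where
      to : ∀ i j → dir (del (add o)) i j ≡ true → dir o i j ≡ true
      to i j e with orientOf⁻ (del? (add o)) e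
      ... | e′ , ¬xy with orientOf⁻ (add? o) e′
      ... | inj₁ e″ = e″
      ... | inj₂ p  = contradiction (inj₁ p) ¬xy
      from : ∀ i j → dir o i j ≡ true → dir (del (add o)) i j ≡ true
      from i j e = orientOf⁺ (del? (add o))
        (orientOf⁺ (add? o) (inj₁ e) , proj₂ (deleteEdge⁻ {G = F} (AO-sub G ao e)))

  -- Deleting the arc from `x` to `y` and putting it back are inverse to each other.
  count-directed : count directed? ≡ count (avoidsWalk? G y x)
  count-directed = count-bijection directed? (avoidsWalk? G y x) del add del-AO add-AO add-del del-add

#AO-cong : (G G′ : Graph n) → (∀ i j → adj G i j ≡ adj G′ i j) → #AO G ≤ #AO G′
#AO-cong G G′ eq = count-mono (ao? G) (ao? G′) λ o ao → acyclicOrientation {G = G′}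
  (λ d → trans (≡-sym (eq _ _)) (AO-sub G ao d)) (λ a → AO-total G ao (trans (eq _ _) a)) (proj₂ ao)

count-cong : {P Q : Orient n → Set} (P? : Decidable P) (Q? : Decidable Q) →
  (∀ o → P o → Q o) → (∀ o → Q o → P o) → count P? ≡ count Q?
count-cong P? Q? P⇒Q Q⇒P = ℕ.≤-antisym (count-mono P? Q? P⇒Q) (count-mono Q? P? Q⇒P)

-- Split by the direction of the edge: the two halves count the acyclic orientations of `G` without
-- a walk from `y` to `x`, and those without a walk from `x` to `y`. The latter either have a walk
-- from `y` to `x`, which together with the first half gives all of `#AO G`, or are separated.
deletion-contraction : (F : Graph n) {x y : Fin n} → adj F x y ≡ true →
  #AO F ≡ #AO (deleteEdge F x y) + count (separated? (deleteEdge F x y) x y)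
deletion-contraction {n} F {x} {y} xy = begin
  #AO F
    ≡⟨ length-filter-⊎ (ao? F) (directed? F xy) (directed? F yx) split (λ _ → proj₁) (λ _ → proj₁)
         (λ o p q → acyclic-asym {o = o} (proj₂ (proj₁ p)) (proj₂ p) (proj₂ q)) (orients n) ⟩
  count (directed? F xy) + count (directed? F yx)
    ≡⟨ cong₂ _+_ (count-directed F xy) (trans (count-directed F yx) flip) ⟩
  count (avoidsWalk? G y x) + count (avoidsWalk? G x y)
    ≡⟨ cong (count (avoidsWalk? G y x) +_)
         (length-filter-⊎ (avoidsWalk? G x y) along? (separated? G x y)
           (λ { o (ao , ¬xy) → split′ o ao ¬xy })
           -- Walks in both directions would form a cycle.
           (λ { o (ao , w) → ao , λ w′ → proj₂ ao x (w′ ▷ w) })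
           (λ { o (ao , ¬xy , _) → ao , ¬xy })
           (λ { o (_ , w) (_ , _ , ¬yx) → ¬yx w }) (orients n)) ⟩
  count (avoidsWalk? G y x) + (count along? + count (separated? G x y))
    ≡⟨ ℕ.+-assoc (count (avoidsWalk? G y x)) _ _ ⟨
  count (avoidsWalk? G y x) + count along? + count (separated? G x y)
    ≡⟨ cong (_+ count (separated? G x y)) (length-filter-⊎ (ao? G) (avoidsWalk? G y x) along?
         (λ o ao → split″ o ao) (λ _ → proj₁) (λ _ → proj₁) (λ { o (_ , ¬w) (_ , w) → ¬w w }) (orients n)) ⟨
  #AO G + count (separated? G x y) ∎
  where
  open ≡-Reasoning
  G : Graph n
  G = deleteEdge F x y
  yx : adj F y x ≡ true
  yx = adj-sym F xy
  along? : Decidable (λ o → AcyclicOrientation G o × Walk o y x)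
  along? o = ao? G o ×-dec walk? o y x
  split : ∀ o → AcyclicOrientation F o →
    (AcyclicOrientation F o × dir o x y ≡ true) ⊎ (AcyclicOrientation F o × dir o y x ≡ true)
  split o ao = Sum.map (ao ,_) (ao ,_) (AO-total F ao xy)
  split′ : ∀ o → AcyclicOrientation G o → ¬ Walk o x y →
    (AcyclicOrientation G o × Walk o y x) ⊎ Separated G x y o
  split′ o ao ¬xy with walk? o y x
  ... | yes w = inj₁ (ao , w)
  ... | no ¬w = inj₂ (ao , ¬xy , ¬w)
  split″ : ∀ o → AcyclicOrientation G o → AvoidsWalk G y x o ⊎ (AcyclicOrientation G o × Walk o y x)
  split″ o ao with walk? o y x
  ... | yes w = inj₂ (ao , w)
  ... | no ¬w = inj₁ (ao , ¬w)
  -- The second half comes from the edge named `yx`. Deleting it gives the same adjacencies as `G`,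
  -- but not definitionally, so the count has to be transported.
  G′ : Graph n
  G′ = deleteEdge F y x
  flip-adj : ∀ {a b i j} → adj (deleteEdge F a b) i j ≡ true → adj (deleteEdge F b a) i j ≡ true
  flip-adj a with deleteEdge⁻ {G = F} a
  ... | a′ , ¬ab = deleteEdge⁺ {G = F} a′ (¬ab ∘ joins-swap)
  flip-AO : ∀ {a b} o → AcyclicOrientation (deleteEdge F a b) o → AcyclicOrientation (deleteEdge F b a) o
  flip-AO {a} {b} o ao = acyclicOrientation {G = deleteEdge F b a}
    (λ d → flip-adj {a} {b} (AO-sub (deleteEdge F a b) ao d))
    (λ e → AO-total (deleteEdge F a b) ao (flip-adj {b} {a} e)) (proj₂ ao)
  flip : count (avoidsWalk? G′ x y) ≡ count (avoidsWalk? G x y)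
  flip = count-cong (avoidsWalk? G′ x y) (avoidsWalk? G x y)
    (λ { o (ao , ¬w) → flip-AO {y} {x} o ao , ¬w }) (λ { o (ao , ¬w) → flip-AO {x} {y} o ao , ¬w })

-- Moving an end of a complement edge

module _ (F : Graph n) {u v v′ : Fin n}
  (vu : adj F v u ≡ true) (universal : ∀ j → j ≢ v′ → adj F v′ j ≡ true) where
  private
    G G′ : Graph n
    G  = deleteEdge F v u
    G′ = deleteEdge F v′ u

    v≢u : v ≢ u
    v≢u = adj⇒≢ F vu

    -- The quotient map that identifies `u` with `w`, with `w` as the representative.
    replace : Fin n → Fin n → Fin n
    replace w i with i Fin.≟ u
    ... | yes _ = w
    ... | no  _ = i

    replace-u : ∀ w → replace w u ≡ w
    replace-u w with u Fin.≟ u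
    ... | yes _ = refl
    ... | no ¬p = contradiction refl ¬p

    replace-≢ : ∀ w {i} → i ≢ u → replace w i ≡ i
    replace-≢ w {i} i≢u with i Fin.≟ u
    ... | yes p = contradiction p i≢u
    ... | no _  = refl

    ≢u : ∀ {w} → w ≢ u → ∀ i → replace w i ≢ u
    ≢u w≢u i with i Fin.≟ u
    ... | yes _  = w≢u
    ... | no i≢u = i≢u

    -- The only edge that could collapse when `u` and `v` are identified is `vu`, and `G` lacks it.
    G-replace-≢ : ∀ {i j} → adj G i j ≡ true → replace v i ≢ replace v j
    G-replace-≢ {i} {j} a with deleteEdge⁻ {G = F} a | i Fin.≟ u | j Fin.≟ u
    ... | a′ , ¬vu | yes refl | yes refl = contradiction refl (adj⇒≢ F a′)
    ... | a′ , ¬vu | yes refl | no _     = λ eq → ¬vu (inj₂ (refl , ≡-sym eq))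
    ... | a′ , ¬vu | no _     | yes refl = λ eq → ¬vu (inj₁ (eq , refl))
    ... | a′ , ¬vu | no _     | no _     = adj⇒≢ F a′

    merged? : ∀ o i j → Dec (adj G i j ≡ true × pos o (replace v i) < pos o (replace v j))
    merged? o i j = (adj G i j Bool.≟ true) ×-dec (pos o (replace v i) ℕ.<? pos o (replace v j))

    -- Moves u to the position of v.
    merge : Orient n → Orient n
    merge o = orientOf (merged? o)

    merge-walk : ∀ o {i j} → Walk (merge o) i j → pos o (replace v i) < pos o (replace v j)
    merge-walk o (edge d) = proj₂ (orientOf⁻ (merged? o) d)
    merge-walk o (d ∷ w)  = ℕ.<-trans (proj₂ (orientOf⁻ (merged? o) d)) (merge-walk o w)

    -- Along a walk of `merge o` the position of the replaced vertex strictly increases, which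
    -- excludes cycles. Since `u` and `v` share a position, it also excludes walks between them.
    merge-separated : ∀ o → Separated G′ v′ u o → Separated G v u (merge o)
    merge-separated o (ao , _ , _) =
      acyclicOrientation {G = G} (λ d → proj₁ (orientOf⁻ (merged? o) d)) total (λ i w → ℕ.<-irrefl refl (merge-walk o w))
      , (λ w → ℕ.<-irrefl level (merge-walk o w)) , (λ w → ℕ.<-irrefl (≡-sym level) (merge-walk o w))
      where
      level : pos o (replace v v) ≡ pos o (replace v u)
      level = cong (pos o) (trans (replace-≢ v v≢u) (≡-sym (replace-u v)))
      total : ∀ {i j} → adj G i j ≡ true → dir (merge o) i j ≡ true ⊎ dir (merge o) j i ≡ true
      total {i} {j} a with ℕ.<-cmp (pos o (replace v i)) (pos o (replace v j))
      ... | tri< lt _ _ = inj₁ (orientOf⁺ (merged? o) (a , lt))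
      ... | tri≈ _ eq _ = contradiction (pos-injective o eq) (G-replace-≢ a)
      ... | tri> _ _ gt = inj₂ (orientOf⁺ (merged? o) (adj-sym G a , gt))

    G⇒G′ : ∀ {i j} → i ≢ u → j ≢ u → adj G i j ≡ true → adj G′ i j ≡ true
    G⇒G′ i≢u j≢u a = deleteEdge⁺ {G = F} (proj₁ (deleteEdge⁻ {G = F} a))
      λ { (inj₁ (_ , refl)) → j≢u refl ; (inj₂ (refl , _)) → i≢u refl }

    G′⇒G : ∀ {i j} → i ≢ u → j ≢ u → adj G′ i j ≡ true → adj G i j ≡ true
    G′⇒G i≢u j≢u a = deleteEdge⁺ {G = F} (proj₁ (deleteEdge⁻ {G = F} a))
      λ { (inj₁ (_ , refl)) → j≢u refl ; (inj₂ (refl , _)) → i≢u refl }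

    -- Both deleted edges end in `u`, so away from `u` the graphs agree; there `merge` compares
    -- positions in a linear extension of `o` and so keeps the directions of `o`.
    merge⁺ : ∀ o → AcyclicOrientation G′ o → ∀ {i j} → i ≢ u → j ≢ u →
      dir o i j ≡ true → dir (merge o) i j ≡ true
    merge⁺ o ao {i} {j} i≢u j≢u d = orientOf⁺ (merged? o) (G′⇒G i≢u j≢u (AO-sub G′ ao d) , lt)
      where
      lt : pos o (replace v i) < pos o (replace v j)
      lt rewrite replace-≢ v i≢u | replace-≢ v j≢u = pos-mono o (proj₂ ao) d

    merge⁻ : ∀ o → AcyclicOrientation G′ o → ∀ {i j} → i ≢ u → j ≢ u →
      dir (merge o) i j ≡ true → dir o i j ≡ true
    merge⁻ o ao {i} {j} i≢u j≢u d with orientOf⁻ (merged? o) d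
    ... | a , lt rewrite replace-≢ v i≢u | replace-≢ v j≢u with AO-total G′ ao (G⇒G′ i≢u j≢u a)
    ... | inj₁ d′ = d′
    ... | inj₂ d′ = contradiction (pos-mono o (proj₂ ao) d′) (ℕ.<-asym lt)

    module _ (v′≢u : v′ ≢ u) {o : Orient n} (sep : Separated G′ v′ u o) where
      private
        ao : AcyclicOrientation G′ o
        ao = proj₁ sep

        G′-v′ : ∀ {j} → j ≢ v′ → j ≢ u → adj G′ v′ j ≡ true
        G′-v′ j≢v′ j≢u = deleteEdge⁺ {G = F} (universal _ j≢v′)
          λ { (inj₁ (_ , eq)) → j≢u eq ; (inj₂ (eq , _)) → v′≢u eq }

      -- The vertex `v′` is adjacent to `j`, and an arc from `j` to `v′` would complete a walk from
      -- `u` to `v′`. Thus `v′` copies every direction at `u`.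
      twin-out⁺ : ∀ {j} → dir o u j ≡ true → dir o v′ j ≡ true
      twin-out⁺ {j} d with AO-total G′ ao (G′-v′ j≢v′ (≢-sym (adj⇒≢ G′ (AO-sub G′ ao d))))
        where
        j≢v′ : j ≢ v′
        j≢v′ refl = proj₂ (deleteEdge⁻ {G = F} (AO-sub G′ ao d)) (inj₂ (refl , refl))
      ... | inj₁ d′ = d′
      ... | inj₂ d′ = contradiction (d ∷ edge d′) (proj₂ (proj₂ sep))

      twin-in⁺ : ∀ {j} → dir o j u ≡ true → dir o j v′ ≡ true
      twin-in⁺ {j} d with AO-total G′ ao (G′-v′ j≢v′ (adj⇒≢ G′ (AO-sub G′ ao d)))
        where
        j≢v′ : j ≢ v′
        j≢v′ refl = proj₂ (deleteEdge⁻ {G = F} (AO-sub G′ ao d)) (inj₁ (refl , refl))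
      ... | inj₁ d′ = contradiction (d′ ∷ edge d) (proj₁ (proj₂ sep))
      ... | inj₂ d′ = d′

      twin⁺ : ∀ {i j} → dir o i j ≡ true → dir o (replace v′ i) (replace v′ j) ≡ true
      twin⁺ {i} {j} d with i Fin.≟ u | j Fin.≟ u
      ... | yes refl | yes refl = contradiction refl (adj⇒≢ G′ (AO-sub G′ ao d))
      ... | yes refl | no _     = twin-out⁺ d
      ... | no _     | yes refl = twin-in⁺ d
      ... | no _     | no _     = d

      -- If `o` directed the edge the other way, `twin⁺` would yield the reverse of the given arc,
      -- hence a cycle.
      twin⁻ : ∀ {i j} → adj G′ i j ≡ true → dir o (replace v′ i) (replace v′ j) ≡ true → dir o i j ≡ true
      twin⁻ a d with AO-total G′ ao a
      ... | inj₁ d′ = d′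
      ... | inj₂ d′ = contradiction d (acyclic-asym {o = o} (proj₂ ao) (twin⁺ d′))

    -- Directions at `u` can be read off at `v′`, hence from edges away from `u`, and those survive
    -- in `merge o`. The proof goes from `o` by `twin⁺` and `merge⁺` to the common image and returns
    -- to `o′` by `merge⁻` and `twin⁻`.
    merge-injective : v′ ≢ u → ∀ o o′ → Separated G′ v′ u o → Separated G′ v′ u o′ → merge o ≡ merge o′ → o ≡ o′
    merge-injective v′≢u o o′ sep sep′ eq = orient-ext (⊑ sep sep′ eq) (⊑ sep′ sep (≡-sym eq))
      where
      ⊑ : ∀ {o o′} → Separated G′ v′ u o → Separated G′ v′ u o′ → merge o ≡ merge o′ →
        ∀ i j → dir o i j ≡ true → dir o′ i j ≡ true
      ⊑ {o} {o′} sep sep′ eq i j d = twin⁻ v′≢u sep′ (AO-sub G′ (proj₁ sep) d)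
        (merge⁻ o′ (proj₁ sep′) (≢u v′≢u i) (≢u v′≢u j)
          (subst (λ o → dir o _ _ ≡ true) eq
            (merge⁺ o (proj₁ sep) (≢u v′≢u i) (≢u v′≢u j) (twin⁺ v′≢u sep d))))

  move-nonedge : v′ ≢ u → #AO G ≤ #AO G′
  -- Both edges expand the same number `#AO F`, so the deletion terms compare oppositely to the
  -- contraction terms.
  move-nonedge v′≢u = ℕ.+-cancelʳ-≤ (count (separated? G′ v′ u)) _ _ (begin
    #AO G + count (separated? G′ v′ u)  ≤⟨ ℕ.+-monoʳ-≤ (#AO G)
      (count-injection (separated? G′ v′ u) (separated? G v u) merge merge-separated (merge-injective v′≢u)) ⟩
    #AO G + count (separated? G v u)    ≡⟨ deletion-contraction F vu ⟨
    #AO F                               ≡⟨ deletion-contraction F (universal u (≢-sym v′≢u)) ⟩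
    #AO G′ + count (separated? G′ v′ u) ∎)
    where open ℕ.≤-Reasoning

-- Graphs given by their complement edges

completeGraph : Graph n
completeGraph .adj i j = not (does (i Fin.≟ j))
completeGraph .sym i j = cong not (does-⇔ (mk⇔ ≡-sym ≡-sym) (i Fin.≟ j) (j Fin.≟ i))
completeGraph .irrefl i = cong not (dec-true (i Fin.≟ i) refl)

without : List (Fin n × Fin n) → Graph n
without []            = completeGraph
without ((x , y) ∷ E) = deleteEdge (without E) x y

without⁺ : (E : List (Fin n × Fin n)) → ∀ {i j} → i ≢ j → (i , j) ∉ E → (j , i) ∉ E → adj (without E) i j ≡ true
without⁺ []            {i} {j} i≢j _ _ = cong not (dec-false (i Fin.≟ j) i≢j)
without⁺ ((x , y) ∷ E) i≢j ij∉ ji∉ = deleteEdge⁺ {G = without E} (without⁺ E i≢j (ij∉ ∘ there) (ji∉ ∘ there))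
  λ { (inj₁ (refl , refl)) → ij∉ (here refl) ; (inj₂ (refl , refl)) → ji∉ (here refl) }

without⁻ : (E : List (Fin n × Fin n)) → ∀ {i j} → adj (without E) i j ≡ true → (i , j) ∉ E × (j , i) ∉ E
without⁻ [] _ = (λ ()) , (λ ())
without⁻ ((x , y) ∷ E) a with deleteEdge⁻ {G = without E} a
... | a′ , ¬xy =
    (λ { (here refl) → ¬xy (inj₁ (refl , refl)) ; (there ij∈) → proj₁ (without⁻ E a′) ij∈ })
  , (λ { (here refl) → ¬xy (inj₂ (refl , refl)) ; (there ji∈) → proj₂ (without⁻ E a′) ji∈ })

without-adj-⊆ : (E E′ : List (Fin n × Fin n)) → (∀ {i j} → (i , j) ∈ E → (i , j) ∈ E′ ⊎ (j , i) ∈ E′) →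
  ∀ {i j} → adj (without E′) i j ≡ true → adj (without E) i j ≡ true
without-adj-⊆ E E′ sub a with without⁻ E′ a
... | ij∉ , ji∉ = without⁺ E (adj⇒≢ (without E′) a)
  ([ ij∉ , ji∉ ]′ ∘ sub) ([ ji∉ , ij∉ ]′ ∘ sub)

-- This allows pairs to be turned around and lists to be reordered.
#AO-without-cong : (E E′ : List (Fin n × Fin n)) →
  (∀ {i j} → (i , j) ∈ E → (i , j) ∈ E′ ⊎ (j , i) ∈ E′) →
  (∀ {i j} → (i , j) ∈ E′ → (i , j) ∈ E ⊎ (j , i) ∈ E) →
  #AO (without E) ≤ #AO (without E′)
#AO-without-cong E E′ sub sub′ = #AO-cong (without E) (without E′) λ i j →
  ⇔-true (without-adj-⊆ E′ E sub′) (without-adj-⊆ E E′ sub)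

-- The absence of duplicates in this list encodes that the pairs are pairwise disjoint and that none
-- is a loop.
endpoints : List (A × A) → List A
endpoints []            = []
endpoints ((x , y) ∷ E) = x ∷ y ∷ endpoints E

endpoints-fst : {E : List (A × A)} {x y : A} → (x , y) ∈ E → x ∈ endpoints E
endpoints-fst (here refl) = here refl
endpoints-fst (there p)   = there (there (endpoints-fst p))

endpoints-snd : {E : List (A × A)} {x y : A} → (x , y) ∈ E → y ∈ endpoints E
endpoints-snd (here refl) = there (here refl)
endpoints-snd (there p)   = there (there (endpoints-snd p))

∈-endpoints⁻ : (E : List (A × A)) {x : A} → x ∈ endpoints E → ∃ λ y → (x , y) ∈ E ⊎ (y , x) ∈ E
∈-endpoints⁻ ((a , b) ∷ E) (here refl)         = b , inj₁ (here refl)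
∈-endpoints⁻ ((a , b) ∷ E) (there (here refl)) = a , inj₂ (here refl)
∈-endpoints⁻ ((a , b) ∷ E) (there (there x∈)) with ∈-endpoints⁻ E x∈
... | y , p = y , Sum.map there there p

endpoints-++ : (E E′ : List (A × A)) → endpoints (E ++ E′) ≡ endpoints E ++ endpoints E′
endpoints-++ []            E′ = refl
endpoints-++ ((x , y) ∷ E) E′ = cong (λ L → x ∷ y ∷ L) (endpoints-++ E E′)

length-endpoints : (E : List (A × A)) → length (endpoints E) ≡ length E * 2
length-endpoints []      = refl
length-endpoints (_ ∷ E) = cong (2 +_) (length-endpoints E)

endpoints-injective : (E E′ : List (A × A)) → endpoints E ≡ endpoints E′ → E ≡ E′
endpoints-injective []            []              eq = refl
endpoints-injective ((x , y) ∷ E) ((x′ , y′) ∷ E′) eq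
  with List.∷-injective eq
... | refl , eq′ with List.∷-injective eq′
... | refl , eq″ = cong ((x , y) ∷_) (endpoints-injective E E′ eq″)

endpoints-map : (f : A → B) (E : List (A × A)) →
  endpoints (map (λ e → f (proj₁ e) , f (proj₂ e)) E) ≡ map f (endpoints E)
endpoints-map f []            = refl
endpoints-map f ((x , y) ∷ E) = cong (λ L → f x ∷ f y ∷ L) (endpoints-map f E)

-- Spreading the complement edges apart

fresh : (L : List (Fin n)) → length L < n → ∃ (_∉ L)
fresh {n} L lt = Fin.¬∀⟶∃¬ n (_∈ L) (_∈? L) λ all → ℕ.<⇒≱ lt
  (subst (_≤ length L) (List.length-tabulate id) (Unique-⊆-length (Unique.allFin⁺ n) λ _ → all _))
  where open import Data.List.Membership.DecPropositional (Fin._≟_ {n}) using (_∈?_)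

-- Outside `endpoints E`, the vertex `z` is adjacent to all others in `without E`, so it can serve
-- as the universal vertex of `move-nonedge`.
replace-endpoint : (E : List (Fin n × Fin n)) {x y z : Fin n} → x ≢ y → (x , y) ∉ E → (y , x) ∉ E →
  z ∉ y ∷ endpoints E → #AO (without ((x , y) ∷ E)) ≤ #AO (without ((z , y) ∷ E))
replace-endpoint E {x} {y} {z} x≢y xy∉ yx∉ z∉ = move-nonedge (without E) (without⁺ E x≢y xy∉ yx∉)
  (λ j j≢z → without⁺ E (≢-sym j≢z) (z∉ ∘ there ∘ endpoints-fst) (z∉ ∘ there ∘ endpoints-snd))
  (z∉ ∘ here)

-- Here `R` holds the pairs still to be moved and `D` the finished ones, disjoint from each other
-- and from `R`. Each round replaces both ends of the head of `R` by fresh vertices and puts the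
-- result into `D`. The ordering of the pairs in `R` excludes loops and reversed repetitions.
spread : (R D : List (Fin n × Fin n)) → length (R ++ D) * 2 ≤ n →
  Unique R → All (λ e → toℕ (proj₁ e) < toℕ (proj₂ e)) R →
  Unique (endpoints D) → (∀ {z} → z ∈ endpoints D → z ∉ endpoints R) →
  ∃ λ (M : List (Fin n × Fin n)) → length M ≡ length (R ++ D) × Unique (endpoints M)
    × #AO (without (R ++ D)) ≤ #AO (without M)
spread [] D _ _ _ uniq _ = D , refl , uniq , ℕ.≤-refl
spread {n} ((x , y) ∷ R) D bound (xy# ∷ uniqR) (x<y ∷ R<) uniqD disj =
  let M , lengthM , uniqM , le = spread R ((w , z) ∷ D) bound′ uniqR R< uniqD′ disj′
  in M , trans lengthM length′ , uniqM , (begin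
    #AO (without ((x , y) ∷ R ++ D)) ≤⟨ replace-endpoint (R ++ D) x≢y xy∉ yx∉ z∉ ⟩
    -- Only a first component can be replaced, so the pair is turned to bring `y` to the front.
    #AO (without ((z , y) ∷ R ++ D)) ≤⟨ #AO-without-cong ((z , y) ∷ R ++ D) ((y , z) ∷ R ++ D) flip-head flip-head ⟩
    #AO (without ((y , z) ∷ R ++ D)) ≤⟨ replace-endpoint (R ++ D) (≢-sym (z∉ ∘ here))
      (z∉ ∘ there ∘ endpoints-snd) (z∉ ∘ there ∘ endpoints-fst) w∉ ⟩
    #AO (without ((w , z) ∷ R ++ D)) ≤⟨ #AO-without-cong ((w , z) ∷ R ++ D) (R ++ (w , z) ∷ D)
      (inj₁ ∘ Permutation.∈-resp-↭ (Permutation.↭-sym (Permutation.shift _ R D)))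
      (inj₁ ∘ Permutation.∈-resp-↭ (Permutation.shift _ R D)) ⟩
    #AO (without (R ++ (w , z) ∷ D)) ≤⟨ le ⟩
    #AO (without M)                  ∎)
  where
  open ℕ.≤-Reasoning
  -- With the head pair counted in, twice the number of pairs is at most `n`. The endpoints of the
  -- others plus one vertex number one less than this, so a fresh vertex exists.
  room : ∀ v → length (v ∷ endpoints (R ++ D)) < n
  room _ = subst (_≤ n) (≡-sym (cong (2 +_) (length-endpoints (R ++ D)))) bound
  fresh-z : ∃ (_∉ y ∷ endpoints (R ++ D))
  fresh-z = fresh _ (room y)
  z : Fin n
  z = proj₁ fresh-z
  z∉ : z ∉ y ∷ endpoints (R ++ D)
  z∉ = proj₂ fresh-z
  fresh-w : ∃ (_∉ z ∷ endpoints (R ++ D))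
  fresh-w = fresh _ (room z)
  w : Fin n
  w = proj₁ fresh-w
  w∉ : w ∉ z ∷ endpoints (R ++ D)
  w∉ = proj₂ fresh-w
  length′ : length (R ++ (w , z) ∷ D) ≡ suc (length (R ++ D))
  length′ = trans (List.length-++ R) (trans (ℕ.+-suc (length R) _) (cong suc (≡-sym (List.length-++ R))))
  bound′ : length (R ++ (w , z) ∷ D) * 2 ≤ n
  bound′ = subst (λ l → l * 2 ≤ n) (≡-sym length′) bound
  inR : ∀ {v} → v ∈ endpoints R → v ∈ endpoints (R ++ D)
  inR p = subst (_ ∈_) (≡-sym (endpoints-++ R D)) (∈-++⁺ˡ p)
  inD : ∀ {v} → v ∈ endpoints D → v ∈ endpoints (R ++ D)
  inD p = subst (_ ∈_) (≡-sym (endpoints-++ R D)) (∈-++⁺ʳ (endpoints R) p)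
  uniqD′ : Unique (endpoints ((w , z) ∷ D))
  uniqD′ = ((w∉ ∘ here) ∷ All.tabulate λ v∈ eq → w∉ (there (subst (_∈ _) (≡-sym eq) (inD v∈))))
         ∷ (All.tabulate λ v∈ eq → z∉ (there (subst (_∈ _) (≡-sym eq) (inD v∈)))) ∷ uniqD
  disj′ : ∀ {v} → v ∈ endpoints ((w , z) ∷ D) → v ∉ endpoints R
  disj′ (here refl)         v∈R = w∉ (there (inR v∈R))
  disj′ (there (here refl)) v∈R = z∉ (there (inR v∈R))
  disj′ (there (there v∈D)) v∈R = disj v∈D (there (there v∈R))
  x≢y : x ≢ y
  x≢y refl = ℕ.<-irrefl refl x<y
  xy∉ : (x , y) ∉ R ++ D
  xy∉ p with ∈-++⁻ R p
  ... | inj₁ q = All.lookup xy# q refl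
  ... | inj₂ q = disj (endpoints-fst q) (here refl)
  yx∉ : (y , x) ∉ R ++ D
  yx∉ p with ∈-++⁻ R p
  ... | inj₁ q = ℕ.<-asym x<y (All.lookup R< q)
  ... | inj₂ q = disj (endpoints-snd q) (here refl)
  flip-head : ∀ {a b i j} → (i , j) ∈ (a , b) ∷ R ++ D → (i , j) ∈ (b , a) ∷ R ++ D ⊎ (j , i) ∈ (b , a) ∷ R ++ D
  flip-head (here refl) = inj₂ (here refl)
  flip-head (there p)   = inj₁ (there p)

-- Relabelling vertices

perm-injective : (π : Permutation′ n) → ∀ {i j} → π ⟨$⟩ʳ i ≡ π ⟨$⟩ʳ j → i ≡ j
perm-injective π eq = trans (≡-sym (inverseˡ π)) (trans (cong (π ⟨$⟩ˡ_) eq) (inverseˡ π))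

transpose-fstˡ : (i j : Fin n) → transpose i j ⟨$⟩ʳ i ≡ j
transpose-fstˡ i j with i Fin.≟ i
... | yes _ = refl
... | no ¬p = contradiction refl ¬p

transpose-fixes : (i j : Fin n) {k : Fin n} → k ≢ i → k ≢ j → transpose i j ⟨$⟩ʳ k ≡ k
transpose-fixes i j {k} k≢i k≢j rewrite dec-false (k Fin.≟ i) k≢i | dec-false (k Fin.≟ j) k≢j = refl

-- After the tails are aligned by `π`, a transposition carries `π ⟨$⟩ʳ x` to `y`. It fixes the tail
-- of the target, which contains neither of these two vertices.
align : (xs ys : List (Fin n)) → Unique xs → Unique ys → length xs ≡ length ys →
  Σ (Permutation′ n) λ π → map (π ⟨$⟩ʳ_) xs ≡ ys
align []       []       _           _           _  = idₚ , refl
align (x ∷ xs) (y ∷ ys) (x# ∷ uniq) (y# ∷ uniq′) eq with align xs ys uniq uniq′ (ℕ.suc-injective eq)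
... | π , refl = π ∘ₚ τ , cong₂ _∷_ (transpose-fstˡ (π ⟨$⟩ʳ x) y)
  (trans (List.map-∘ xs) (List.map-id-local (All.tabulate λ v∈ →
    transpose-fixes (π ⟨$⟩ʳ x) y (≢πx v∈) (≢-sym (All.lookup y# v∈)))))
  where
  τ : Permutation′ _
  τ = transpose (π ⟨$⟩ʳ x) y
  ≢πx : ∀ {v} → v ∈ map (π ⟨$⟩ʳ_) xs → v ≢ π ⟨$⟩ʳ x
  ≢πx v∈ refl with ∈-map⁻ (π ⟨$⟩ʳ_) v∈
  ... | x′ , x′∈ , πeq = All.lookup x# x′∈ (perm-injective π πeq)

-- Orientations are pulled back along `π`; the inverse permutation recovers the original, so this is
-- injective.
#AO-relabel : (π : Permutation′ n) (G H : Graph n) →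
  (∀ i j → adj H i j ≡ adj G (π ⟨$⟩ʳ i) (π ⟨$⟩ʳ j)) → #AO G ≤ #AO H
#AO-relabel {n} π G H iso = count-injection (ao? G) (ao? H) relabel relabel-AO λ o o′ _ _ eq → dir-ext λ i j →
  trans (unrelabel o i j) (trans (cong (λ o → dir o (π ⟨$⟩ˡ i) (π ⟨$⟩ˡ j)) eq) (≡-sym (unrelabel o′ i j)))
  where
  relabel : Orient n → Orient n
  relabel o = fromDir λ i j → dir o (π ⟨$⟩ʳ i) (π ⟨$⟩ʳ j)
  dir-relabel : ∀ o i j → dir (relabel o) i j ≡ dir o (π ⟨$⟩ʳ i) (π ⟨$⟩ʳ j)
  dir-relabel o = dir-fromDir _
  unrelabel : ∀ o i j → dir o i j ≡ dir (relabel o) (π ⟨$⟩ˡ i) (π ⟨$⟩ˡ j)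
  unrelabel o i j = ≡-sym (trans (dir-relabel o _ _) (cong₂ (dir o) (inverseʳ π) (inverseʳ π)))
  relabel-walk : ∀ o {i j} → Walk (relabel o) i j → Walk o (π ⟨$⟩ʳ i) (π ⟨$⟩ʳ j)
  relabel-walk o (edge d) = edge (trans (≡-sym (dir-relabel o _ _)) d)
  relabel-walk o (d ∷ w)  = trans (≡-sym (dir-relabel o _ _)) d ∷ relabel-walk o w
  relabel-AO : ∀ o → AcyclicOrientation G o → AcyclicOrientation H (relabel o)
  relabel-AO o ao = acyclicOrientation {G = H}
    (λ {i} {j} d → trans (iso i j) (AO-sub G ao (trans (≡-sym (dir-relabel o i j)) d)))
    (λ {i} {j} a → Sum.map (trans (dir-relabel o i j)) (trans (dir-relabel o j i))
      (AO-total G ao (trans (≡-sym (iso i j)) a)))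
    (λ i w → proj₂ ao _ (relabel-walk o w))

-- A permutation that aligns the two lists of endpoints carries `E` to `M` pair by pair, hence is an
-- isomorphism between the two graphs.
#AO-disjoint-edges : (E M : List (Fin n × Fin n)) → Unique (endpoints E) → Unique (endpoints M) →
  length E ≡ length M → #AO (without M) ≤ #AO (without E)
#AO-disjoint-edges {n} E M uniqE uniqM eq with align (endpoints E) (endpoints M) uniqE uniqM
  (trans (length-endpoints E) (trans (cong (_* 2) eq) (≡-sym (length-endpoints M))))
... | π , πeq with endpoints-injective (map (λ e → π ⟨$⟩ʳ proj₁ e , π ⟨$⟩ʳ proj₂ e) E) M
                     (trans (endpoints-map (π ⟨$⟩ʳ_) E) πeq)
... | refl = #AO-relabel π (without M) (without E) λ i j → ⇔-true to from
  where
  f : Fin n × Fin n → Fin n × Fin n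
  f e = π ⟨$⟩ʳ proj₁ e , π ⟨$⟩ʳ proj₂ e
  f⁻ : ∀ {i j} → f (i , j) ∈ map f E → (i , j) ∈ E
  f⁻ p with ∈-map⁻ f p
  ... | e , e∈ , feq = subst (_∈ E) (≡-sym (cong₂ _,_ (perm-injective π (cong proj₁ feq))
    (perm-injective π (cong proj₂ feq)))) e∈
  to : ∀ {i j} → adj (without E) i j ≡ true → adj (without (map f E)) (π ⟨$⟩ʳ i) (π ⟨$⟩ʳ j) ≡ true
  to a = without⁺ (map f E) (adj⇒≢ (without E) a ∘ perm-injective π)
    (proj₁ (without⁻ E a) ∘ f⁻) (proj₂ (without⁻ E a) ∘ f⁻)
  from : ∀ {i j} → adj (without (map f E)) (π ⟨$⟩ʳ i) (π ⟨$⟩ʳ j) ≡ true → adj (without E) i j ≡ true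
  from a = without⁺ E (adj⇒≢ (without (map f E)) a ∘ cong (π ⟨$⟩ʳ_))
    (proj₁ (without⁻ (map f E) a) ∘ ∈-map⁺ f) (proj₂ (without⁻ (map f E) a) ∘ ∈-map⁺ f)

-- The list of complement edges of a graph

∈-pairs⁺ : {i j : Fin n} → toℕ i < toℕ j → (i , j) ∈ pairs n
∈-pairs⁺ {i = i} {j} i<j = ∈-concatMap⁺ _ (lose (∈-allFin i)
  (∈-map⁺ (i ,_) (∈-filter⁺ (λ j → toℕ i ℕ.<? toℕ j) (∈-allFin j) i<j)))

∈-pairs⁻ : {i j : Fin n} → (i , j) ∈ pairs n → toℕ i < toℕ j
∈-pairs⁻ {n} p with find (∈-concatMap⁻ (λ i → map (i ,_) (filter (λ j → toℕ i ℕ.<? toℕ j) (allFin n))) {xs = allFin n} p)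
... | i , _ , q with ∈-map⁻ (i ,_) q
... | j , j∈ , refl = proj₂ (∈-filter⁻ (λ j → toℕ i ℕ.<? toℕ j) {xs = allFin n} j∈)

pairs-unique : ∀ n → Unique (pairs n)
pairs-unique n = Unique.concat⁺
  (All.map⁺ (All.tabulate λ {i} _ → Unique.map⁺ (cong proj₂) (Unique.filter⁺ _ (Unique.allFin⁺ n))))
  (AllPairs.map⁺ (AllPairs.map (λ { {i} {j} i≢j (p , q) → disjoint i≢j p q }) (Unique.allFin⁺ n)))
  where
  disjoint : ∀ {i j : Fin n} {e is js} → i ≢ j → e ∈ map (i ,_) is → e ∈ map (j ,_) js → ⊥
  disjoint i≢j p q with ∈-map⁻ _ p | ∈-map⁻ _ q
  ... | _ , _ , refl | _ , _ , eq = i≢j (cong proj₁ eq)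

module _ (G : Graph n) where
  private
    edge? : (e : Fin n × Fin n) → Dec (T (adj G (proj₁ e) (proj₂ e)))
    edge? e = Bool.T? (adj G (proj₁ e) (proj₂ e))

  nonedges : List (Fin n × Fin n)
  nonedges = filter (λ e → ¬? (edge? e)) (pairs n)

  nonedges-unique : Unique nonedges
  nonedges-unique = Unique.filter⁺ _ (pairs-unique n)

  ∈-nonedges⁺ : ∀ {i j} → toℕ i < toℕ j → adj G i j ≡ false → (i , j) ∈ nonedges
  ∈-nonedges⁺ i<j a = ∈-filter⁺ (λ e → ¬? (edge? e)) (∈-pairs⁺ i<j) λ t → subst T a t

  ∈-nonedges⁻ : ∀ {i j} → (i , j) ∈ nonedges → toℕ i < toℕ j × adj G i j ≡ false
  ∈-nonedges⁻ {i} {j} p with ∈-filter⁻ (λ e → ¬? (edge? e)) {xs = pairs n} p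
  ... | q , ¬t = ∈-pairs⁻ q , ¬T⇒false ¬t
    where
    ¬T⇒false : ∀ {b} → ¬ T b → b ≡ false
    ¬T⇒false {true}  ¬t = contradiction _ ¬t
    ¬T⇒false {false} _  = refl

  -- The left side counts all pairs and depends on `n` only, so graphs with equally many edges have
  -- equally many complement edges.
  numEdges+nonedges : length (filter (λ _ → yes tt) (pairs n)) ≡ numEdges G + length nonedges
  numEdges+nonedges = length-filter-⊎ (λ _ → yes tt) edge? (λ e → ¬? (edge? e))
    (λ e _ → toSum (edge? e)) _ _ (λ _ t ¬t → ¬t t) (pairs n)

  adj-without-nonedges : ∀ i j → adj G i j ≡ adj (without nonedges) i j
  adj-without-nonedges i j = ⇔-true
    (λ a → without⁺ nonedges (adj⇒≢ G a) (edge∉ a) (edge∉ (adj-sym G a)))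
    λ a → nonedge a (without⁻ nonedges a)
    where
    edge∉ : ∀ {i j} → adj G i j ≡ true → (i , j) ∉ nonedges
    edge∉ a p with () ← trans (≡-sym a) (proj₂ (∈-nonedges⁻ p))
    nonedge : adj (without nonedges) i j ≡ true → (i , j) ∉ nonedges × (j , i) ∉ nonedges → adj G i j ≡ true
    nonedge a (ij∉ , ji∉) with adj G i j in aij | ℕ.<-cmp (toℕ i) (toℕ j)
    ... | true  | _ = refl
    ... | false | tri< i<j _ _ = contradiction (∈-nonedges⁺ i<j aij) ij∉
    ... | false | tri≈ _ eq _  = contradiction (Fin.toℕ-injective eq) (adj⇒≢ (without nonedges) a)
    ... | false | tri> _ _ j<i = contradiction (∈-nonedges⁺ j<i (trans (Graph.sym G j i) aij)) ji∉

  -- A vertex has at most one partner in a matching, so an endpoint that occurs in two entries makes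
  -- them the same edge. The same pair twice contradicts uniqueness; the reversed pair contradicts
  -- the ordering by labels.
  matching-endpoints-unique : ComplementIsMatching G → Unique (endpoints nonedges)
  matching-endpoints-unique matching = go nonedges nonedges-unique id
    where
    NonEdge : Fin n → Fin n → Set
    NonEdge x y = x ≢ y × adj G x y ≡ false
    nonEdge : ∀ {x y} → (x , y) ∈ nonedges → NonEdge x y
    nonEdge p with ∈-nonedges⁻ p
    ... | lt , a = (λ { refl → ℕ.<-irrefl refl lt }) , a
    flip : ∀ {x y} → NonEdge x y → NonEdge y x
    flip (x≢y , a) = ≢-sym x≢y , trans (Graph.sym G _ _) a
    partner : ∀ {x y z} → NonEdge x y → NonEdge x z → y ≡ z
    partner (x≢y , a) (x≢z , a′) = matching _ _ _ (≢-sym x≢y) (≢-sym x≢z) a a′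
    ordered : ∀ {x y} → (x , y) ∈ nonedges → (y , x) ∉ nonedges
    ordered p q = ℕ.<-asym (proj₁ (∈-nonedges⁻ p)) (proj₁ (∈-nonedges⁻ q))
    -- The induction runs over sublists, while partners are still compared within all of `nonedges`.
    go : ∀ E → Unique E → (∀ {e} → e ∈ E → e ∈ nonedges) → Unique (endpoints E)
    go [] _ _ = []
    go ((x , y) ∷ E) (xy# ∷ uniq) sub =
        (proj₁ xy ∷ All.tabulate λ v∈ → λ { refl → x∉ v∈ })
      ∷ (All.tabulate λ v∈ → λ { refl → y∉ v∈ }) ∷ go E uniq (sub ∘ there)
      where
      xy : NonEdge x y
      xy = nonEdge (sub (here refl))
      x∉ : x ∉ endpoints E
      x∉ x∈ with ∈-endpoints⁻ E x∈
      ... | z , inj₁ p with refl ← partner xy (nonEdge (sub (there p))) = All.lookup xy# p refl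
      ... | z , inj₂ p with refl ← partner xy (flip (nonEdge (sub (there p)))) = ordered (sub (here refl)) (sub (there p))
      y∉ : y ∉ endpoints E
      y∉ y∈ with ∈-endpoints⁻ E y∈
      ... | z , inj₁ p with refl ← partner (flip xy) (nonEdge (sub (there p))) = ordered (sub (here refl)) (sub (there p))
      ... | z , inj₂ p with refl ← partner (flip xy) (flip (nonEdge (sub (there p)))) = All.lookup xy# p refl

-- Comparison with the graph whose complement is a matching

theorem7p4 : (n m : ℕ) → 1 ≤ n →
    (n C 2) ∸ (n / 2) ≤ m → m ≤ n C 2 →
    (H : Graph n) → ComplementIsMatching H → numEdges H ≡ m →
    (G : Graph n) → numEdges G ≡ m →
    (kG kH : ℕ) → NumAcyclicOrientations G kG → NumAcyclicOrientations H kH →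
    kG ≤ kH
theorem7p4 n m _ _ _ H matching refl G eqG kG kH numG numH =
  -- At the start every complement edge of `G` is still to be moved and none is finished.
  let M , lengthM , uniqM , le = spread (nonedges G) [] bound (nonedges-unique G)
        (All.tabulate (proj₁ ∘ ∈-nonedges⁻ G)) [] (λ ())
  in begin
  kG                           ≡⟨ numAO-unique G numG ⟩
  #AO G                        ≤⟨ #AO-cong G (without (nonedges G)) (adj-without-nonedges G) ⟩
  #AO (without (nonedges G))   ≡⟨ cong (#AO ∘ without) (List.++-identityʳ (nonedges G)) ⟨
  #AO (without (nonedges G ++ [])) ≤⟨ le ⟩
  #AO (without M)              ≤⟨ #AO-disjoint-edges E M (matching-endpoints-unique H matching) uniqM
    (≡-sym (trans lengthM (trans (cong length (List.++-identityʳ (nonedges G))) same-length))) ⟩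
  #AO (without E)              ≤⟨ #AO-cong (without E) H (λ i j → ≡-sym (adj-without-nonedges H i j)) ⟩
  #AO H                        ≡⟨ numAO-unique H numH ⟨
  kH                           ∎
  where
  open ℕ.≤-Reasoning
  E : List (Fin n × Fin n)
  E = nonedges H
  same-length : length (nonedges G) ≡ length E
  same-length = ℕ.+-cancelˡ-≡ (numEdges H) _ _
    (trans (cong (_+ length (nonedges G)) (≡-sym eqG))
      (trans (≡-sym (numEdges+nonedges G)) (numEdges+nonedges H)))
  bound : length (nonedges G ++ []) * 2 ≤ n
  bound = begin
    length (nonedges G ++ []) * 2 ≡⟨ cong (λ L → length L * 2) (List.++-identityʳ (nonedges G)) ⟩
    length (nonedges G) * 2       ≡⟨ cong (_* 2) same-length ⟩
    length E * 2                  ≡⟨ length-endpoints E ⟨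
    -- The endpoints of a matching are distinct vertices. Thus the existence of `H` provides the
    -- room needed to spread the equally many complement edges of `G`.
    length (endpoints E)          ≤⟨ Unique-⊆-length (matching-endpoints-unique H matching) (λ _ → ∈-allFin _) ⟩
    length (allFin n)             ≡⟨ List.length-tabulate id ⟩
    n                             ∎
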